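{- Let $G$ be a planar graph of order $n$. Then $$\tau(G) \leq 4(f(n/4)+1)-1\leq 4\lceil \log_2(n)\rceil-5.$$
   Context: The order of a graph is its number of vertices; $d_G(x,y)$ is the distance between $x$ and $y$ in $G$. A vertex $w$ resolves a pair of vertices $u,v$ if $d_G(u,w)\neq d_G(v,w)$. A set $W\subseteq V(G)$ is a resolving set for $G$ if every pair of distinct vertices of $G$ is resolved by some vertex of $W$. The metric dimension $\beta(G)$ is the minimum cardinality of a resolving set for $G$ (with the convention $\beta(K_1)=0$). The threshold dimension is $\tau(G)=\min\{\beta(H): H \text{ contains } G \text{ as a spanning subgraph}\}$, i.e. the minimum metric dimension among all graphs $H$ obtained from $G$ by adding edges (possibly none). The function $f:[1,\infty)\to\mathbb{N}$ is defined by letting $f(x)$ be the smallest integer $d$ such that $2^d+d>x$; i.e., $f(x)=d$ if and only if $x\in[2^{d-1}+d-1,\,2^d+d)$.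
   Formalization: The second inequality is claimed only for n ≥ 3, n ≠ 4 (at n = 4 it reads 7 ≤ 3; for n = 1, 2 the right side is negative), τ(G) ≤ 4⌈log₂ n⌉ − 5 for all n ≥ 3; f is extended to [0,1) by the same rule; planar means having a genus-0 combinatorial embedding. -}

module Defs where

open import Data.Bool using (Bool; T; _∧_)
open import Data.Bool.ListAction using (any)
open import Data.Empty using (⊥-elim)
open import Data.Fin using (Fin)
open import Data.Fin.Properties using () renaming (_≟_ to _≟ᶠ_)
open import Data.Fin.Subset using (Subset; _∈_; ∣_∣)
import Data.Integer as ℤ
import Data.Integer.Properties as ℤ
open import Data.List using (allFin; findᵇ; upTo)
open import Data.Maybe using (Maybe)
open import Data.Nat
open import Data.Nat.Properties
open import Data.Product using (Σ; ∃; ∃-syntax; _×_; _,_; proj₁; proj₂)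
open import Data.Rational.Unnormalised as ℚᵘ using (ℚᵘ; mkℚᵘ; *<*)
import Data.Rational.Unnormalised.Properties as ℚᵘ
open import Data.Sum using (_⊎_)
open import Function using (_∘_; Bijection)
open import Level using (0ℓ)
open import Relation.Binary using (Rel)
import Relation.Binary.Construct.Closure.Equivalence as EqClosure
open import Relation.Binary.Construct.Closure.ReflexiveTransitive using (Star)
open import Relation.Binary.PropositionalEquality
open import Relation.Nullary using (¬_; yes; no)
open import Relation.Nullary.Decidable using (⌊_⌋)
open import Relation.Unary using (Pred; Decidable)

IsLeast : Pred ℕ 0ℓ → Pred ℕ 0ℓ
IsLeast P m = P m × (∀ k → P k → m ≤ k)

least : ∀ {P} → Decidable P → ∃ P → ∃ (IsLeast P)
least {P} P? (n , p) = go n P? p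
  where
  go : ∀ n {P : Pred ℕ 0ℓ} → Decidable P → P n → ∃ (IsLeast P)
  go n P? p with P? 0
  ... | yes p₀ = 0 , p₀ , λ _ _ → z≤n
  go zero P? p | no ¬p₀ = ⊥-elim (¬p₀ p)
  go (suc n) P? p | no ¬p₀ with go n (P? ∘ suc) p
  ... | m , pₘ , min = suc m , pₘ , λ where
    zero    p₀ → ⊥-elim (¬p₀ p₀)
    (suc k) pₖ → s≤s (min k pₖ)

------------------------------------------------------------------------
-- Finite simple graphs of order n, on the vertex set Fin n

record Graph (n : ℕ) : Set where
  field
    adj        : Fin n → Fin n → Bool
    adj-sym    : ∀ {u v} → T (adj u v) → T (adj v u)
    adj-irrefl : ∀ {u} → ¬ T (adj u u)

open Graph public

-- G is a spanning subgraph of H.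
_⊑_ : ∀ {n} → Rel (Graph n) 0ℓ
G ⊑ H = ∀ {u v} → T (adj G u v) → T (adj H u v)

------------------------------------------------------------------------
-- Threshold dimension

-- Is there a walk of length exactly k from u to v?
walk : ∀ {n} → Graph n → ℕ → Fin n → Fin n → Bool
walk G zero    u v = ⌊ u ≟ᶠ v ⌋
walk G (suc k) u v = any (λ w → adj G u w ∧ walk G k w v) (allFin _)

-- The value nothing stands for infinite distance.  Lengths 0, …, n - 1
-- suffice, because a shortest walk repeats no vertex.
dist : ∀ {n} → Graph n → Fin n → Fin n → Maybe ℕ
dist {n} G u v = findᵇ (λ k → walk G k u v) (upTo n)

Resolving : ∀ {n} → Graph n → Subset n → Set
Resolving G W = ∀ u v → u ≢ v → ∃[ w ] w ∈ W × dist G u w ≢ dist G v w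

-- MetricDimension G b means β(G) = b.
MetricDimension : ∀ {n} → Graph n → ℕ → Set
MetricDimension G = IsLeast λ k → ∃[ W ] Resolving G W × ∣ W ∣ ≡ k

-- ThresholdDimension G t means τ(G) = t.
ThresholdDimension : ∀ {n} → Graph n → ℕ → Set
ThresholdDimension G =
  IsLeast λ k → ∃[ H ] G ⊑ H × MetricDimension H k

------------------------------------------------------------------------
-- Planarity
--
-- Embeddings are combinatorial maps: a cyclic order of the darts
-- (oriented edges) leaving each vertex.  The vertices, edges and faces of
-- the map are the orbits of three permutations of the darts, and the
-- surfaces carrying its components are all spheres exactly when Euler's
-- formula V - E + F = 2C holds, as V - E + F ≤ 2 for each component.
-- Isolated vertices have no darts, so they take no part in V, F or C;
-- they never obstruct an embedding in the plane.

record Dart {n} (G : Graph n) : Set where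
  constructor dart
  field
    source target : Fin n
    edge          : T (adj G source target)

open Dart public

reverse : ∀ {n} {G : Graph n} → Dart G → Dart G
reverse {G = G} (dart u v e) = dart v u (adj-sym G e)

Maps : ∀ {A : Set} → (A → A) → Rel A 0ℓ
Maps f x y = f x ≡ y

-- The equivalence relation generated by R has exactly k classes.
Classes : ∀ {A : Set} → Rel A 0ℓ → ℕ → Set
Classes R k = Bijection (EqClosure.setoid R) (setoid (Fin k))

record PlanarMap {n} (G : Graph n) : Set where
  field
    next        : Dart G → Dart G
    next-source : ∀ d → source (next d) ≡ source d
    -- Iterating next from any dart reaches every dart with the same
    -- source, so next permutes these darts in a single cycle.
    next-cyclic : ∀ d e → source d ≡ source e → Star (Maps next) d e

  -- The dart that follows d on the boundary of a face.
  face : Dart G → Dart G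
  face = next ∘ reverse

  field
    V E F C    : ℕ
    vertices   : Classes (Maps next) V
    edges      : Classes (Maps (reverse {G = G})) E
    faces      : Classes (Maps face) F
    components : Classes (λ d e → Maps next d e ⊎ Maps reverse d e) C
    euler      : V + F ≡ E + 2 * C

Planar : ∀ {n} → Graph n → Set
Planar = PlanarMap

------------------------------------------------------------------------
-- The function f, on rational arguments

Exceeds : ℚᵘ → ℕ → Set
Exceeds x d = x ℚᵘ.< ℤ.+ (2 ^ d + d) ℚᵘ./ 1

exceeds-some : ∀ x → ∃ (Exceeds x)
exceeds-some (mkℚᵘ p q) = ℤ.∣ p ∣ , *<* (bound p)
  where
  bound : ∀ p → p ℤ.* ℤ.+ 1 ℤ.<
                ℤ.+ (2 ^ ℤ.∣ p ∣ + ℤ.∣ p ∣) ℤ.* ℤ.+ suc q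
  bound (ℤ.+ m)
    rewrite ℤ.*-identityʳ (ℤ.+ m)
          | sym (ℤ.pos-* (2 ^ m + m) (suc q)) =
    ℤ.+<+ (≤-trans (+-monoˡ-≤ m (m^n>0 2 m))
                   (m≤m*n (2 ^ m + m) (suc q)))
  bound ℤ.-[1+ m ]
    rewrite ℤ.*-identityʳ ℤ.-[1+ m ]
          | sym (ℤ.pos-* (2 ^ suc m + suc m) (suc q)) = ℤ.-<+

f-least : ∀ x → ∃ (IsLeast (Exceeds x))
f-least x = least (λ d → x ℚᵘ.<? _) (exceeds-some x)

-- The least natural number d with 2 ^ d + d > x.  For x ≥ 0 this is also
-- the least such integer, as 2 ^ d + d < 0 for every negative integer d.
f : ℚᵘ → ℕ
f x = proj₁ (f-least x)

{-# OPTIONS --safe #-}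
module Submission where

-- The four colour theorem is avoided: all that is used of planarity is that the
-- degrees of G sum to at most 6 n - 10 (or to 0), which is Euler's formula
-- together with the fact that a face, unless it is the face of an isolated edge,
-- has at least three darts on its boundary.
--
-- Let W = A ∪ B.  If edges from the outside of W to B are added so that the
-- vertices outside W get distinct neighbourhoods in B, then W resolves, since
-- being at distance 1 from b ∈ B means being adjacent to b.  Neighbourhoods can
-- be chosen greedily unless some set P of vertices outside W and some j satisfy
-- 2 ^ j < |P| while every v ∈ P has at least |B| - j neighbours in B.  With
-- d = f (n / 4) ≥ 2, let B be the 4 d - 1 vertices of lowest degree and A the
-- four other vertices with the most neighbours in B.  Then all of A ∪ P have at
-- least |B| - j neighbours in B, so (4 + |P|) (|B| - j) is at most the sum of
-- the degrees in B, which is less than 6 |B|; this is impossible for 2 ^ j < |P|.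
-- For d = 1 (so n < 12), take for W = B the seven vertices of highest degree.

open import Defs
open import Data.Bool using (Bool; true; false; T; not; _∧_; _∨_; if_then_else_)
open import Data.Bool.ListAction using (or)
open import Data.Bool.Properties using (T?; T-∧; T-∨; T-≡; T-irrelevant; ∨-comm; ∨-identityʳ; ∧-zeroʳ)
open import Data.Empty using (⊥-elim)
open import Data.Fin as Fin
  using (Fin; zero; suc; toℕ; combine; remQuot; splitAt; join; _↑ˡ_; _↑ʳ_)
open import Data.Fin.Patterns using (0F; 1F; 2F)
open import Data.Fin.Properties
  using (any?; all?; injective⇒≤; toℕ-injective; combine-injective; combine-remQuot;
         remQuot-combine; splitAt-join; join-splitAt)
open import Data.Fin.Subset using (Subset; ∣_∣) renaming (_∈_ to _∈ˢ_)
open import Data.Fin.Subset.Properties using (anySubset?; _∈?_)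
import Data.Integer as ℤ
import Data.Integer.Properties as ℤ
open import Data.List using (List; []; _∷_; upTo; allFin; findᵇ)
open import Data.List.Membership.Propositional using (lose)
open import Data.List.Membership.Propositional.Properties using (∈-allFin)
open import Data.List.Properties using (map-cong)
import Data.List.Relation.Unary.Any as Any
open import Data.List.Relation.Unary.Any.Properties using (any⁺; any⁻)
open import Data.Maybe using (just)
import Data.Maybe.Properties as Maybe
open import Data.Nat hiding (_/_)
open import Data.Nat.Logarithm using (⌈log₂_⌉; ⌈log₂⌈n/2⌉⌉≡⌈log₂n⌉∸1)
open import Data.Nat.Properties
open import Data.Nat.Tactic.RingSolver using (solve-∀)
open import Data.Product using (Σ; ∃; ∃-syntax; _×_; _,_; proj₁; proj₂; uncurry)
open import Data.Rational.Unnormalised using (*<*; _/_)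
open import Data.Sum using (_⊎_; inj₁; inj₂; map₁; map₂)
open import Data.Sum.Properties using (inj₁-injective)
open import Data.Unit using (tt)
open import Data.Vec using (tabulate; lookup)
open import Data.Vec.Properties using (lookup∘tabulate; lookup⇒[]=)
open import Function using (_∘_; Bijection; Equivalence; Injective)
open import Level using (0ℓ)
open import Relation.Binary using (Rel)
open import Relation.Binary.Construct.Closure.Equivalence as EqClosure using (EqClosure)
open import Relation.Binary.Construct.Closure.ReflexiveTransitive as Star using (Star; ε; _◅_)
open import Relation.Binary.Construct.Closure.Symmetric using (fwd; bwd)
open import Relation.Binary.PropositionalEquality
open import Relation.Nullary using (¬_; Dec; yes; no; does; ¬?)
open import Relation.Nullary.Decidable
  using (_×-dec_; _→-dec_; map′; ⌊_⌋; toWitness; fromWitness)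
open import Relation.Unary using (Decidable)
open import Algebra.Properties.Semiring.Sum +-*-semiring
  using (sum; sum-cong-≗; sum-replicate-zero; ∑-distrib-+; ∑-comm; *-distribˡ-sum; *-distribʳ-sum)

-- Counting

sum-mono-≤ : ∀ {n} {f g : Fin n → ℕ} → (∀ i → f i ≤ g i) → sum f ≤ sum g
sum-mono-≤ {zero}  f≤g = z≤n
sum-mono-≤ {suc n} f≤g = +-mono-≤ (f≤g zero) (sum-mono-≤ (f≤g ∘ suc))

𝟙 : Bool → ℕ
𝟙 b = if b then 1 else 0

count : ∀ {n} → (Fin n → Bool) → ℕ
count p = sum (𝟙 ∘ p)

_─_ : ∀ {n} → (Fin n → Bool) → (Fin n → Bool) → Fin n → Bool
(p ─ q) i = p i ∧ not (q i)

full : ∀ {n} → Fin n → Bool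
full _ = true

∁ : ∀ {n} → (Fin n → Bool) → Fin n → Bool
∁ p = not ∘ p

not-elim : ∀ {b} → T (not b) → ¬ T b
not-elim {false} _ ()

not-intro : ∀ {b} → ¬ T b → T (not b)
not-intro {false} _  = tt
not-intro {true}  ¬b = ⊥-elim (¬b tt)

T-∧⁺ : ∀ {a b} → T a → T b → T (a ∧ b)
T-∧⁺ a b = Equivalence.from T-∧ (a , b)

T-∧⁻ : ∀ {a b} → T (a ∧ b) → T a × T b
T-∧⁻ = Equivalence.to T-∧

𝟙-mono : ∀ {a b} → (T a → T b) → 𝟙 a ≤ 𝟙 b
𝟙-mono {false}        _   = z≤n
𝟙-mono {true} {true}  _   = ≤-refl
𝟙-mono {true} {false} a⇒b = ⊥-elim (a⇒b tt)

count-mono : ∀ {n} {p q : Fin n → Bool} → (∀ i → T (p i) → T (q i)) → count p ≤ count q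
count-mono p⇒q = sum-mono-≤ λ i → 𝟙-mono (p⇒q i)

count-partition : ∀ {n} (p q : Fin n → Bool) →
                  count p ≡ count (λ i → p i ∧ q i) + count (p ─ q)
count-partition p q = trans (sum-cong-≗ λ i → split (p i) (q i))
                            (∑-distrib-+ (λ i → 𝟙 (p i ∧ q i)) _)
  where
  split : ∀ a b → 𝟙 a ≡ 𝟙 (a ∧ b) + 𝟙 (a ∧ not b)
  split false _     = refl
  split true  false = refl
  split true  true  = refl

count-full : ∀ n → count (full {n}) ≡ n
count-full zero    = refl
count-full (suc n) = cong suc (count-full n)

count-∁ : ∀ {n} (p : Fin n → Bool) → count p + count (∁ p) ≡ n
count-∁ {n} p = trans (sym (count-partition full p)) (count-full n)

count-disjoint-∨ : ∀ {n} (p q : Fin n → Bool) → (∀ i → T (p i) → ¬ T (q i)) →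
                   count (λ i → p i ∨ q i) ≡ count p + count q
count-disjoint-∨ p q disj =
  trans (sum-cong-≗ λ i → add (p i) (q i) (disj i)) (∑-distrib-+ (𝟙 ∘ p) (𝟙 ∘ q))
  where
  add : ∀ a b → (T a → ¬ T b) → 𝟙 (a ∨ b) ≡ 𝟙 a + 𝟙 b
  add false b     d = refl
  add true  false d = refl
  add true  true  d = ⊥-elim (d tt tt)

0<count⇒∃ : ∀ {n} (p : Fin n → Bool) → 0 < count p → ∃[ i ] T (p i)
0<count⇒∃ {suc n} p pos with T? (p zero) | p zero in eq
... | yes p₀ | _     = zero , p₀
... | no ¬p₀ | true  = ⊥-elim (¬p₀ (subst T (sym eq) tt))
... | no ¬p₀ | false with i , pᵢ ← 0<count⇒∃ (p ∘ suc) pos = suc i , pᵢ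

count-pos : ∀ {n} (p : Fin n → Bool) {i} → T (p i) → 0 < count p
count-pos p {zero}  pᵢ = ≤-trans (𝟙-mono {true} {p zero} (λ _ → pᵢ)) (m≤m+n _ _)
count-pos p {suc i} pᵢ = ≤-trans (count-pos (p ∘ suc) pᵢ) (m≤n+m _ (𝟙 (p zero)))

-- Turns the presence of many vertices of large degree into a lower bound on a degree sum.
count-*-≤-sum : ∀ {n} (p : Fin n → Bool) {y} {f : Fin n → ℕ} →
                (∀ i → T (p i) → y ≤ f i) → count p * y ≤ sum f
count-*-≤-sum p {y} {f} y≤f = begin
  count p * y                ≡⟨ *-distribʳ-sum y (𝟙 ∘ p) ⟩
  sum (λ i → 𝟙 (p i) * y)    ≤⟨ sum-mono-≤ (λ i → step (p i) (y≤f i)) ⟩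
  sum f                      ∎
  where
  open ≤-Reasoning
  step : ∀ b {k} → (T b → y ≤ k) → 𝟙 b * y ≤ k
  step false _ = z≤n
  step true  h = ≤-trans (≤-reflexive (*-identityˡ y)) (h tt)

singleton : ∀ {n} → Fin n → Fin n → Bool
singleton i j = ⌊ i Fin.≟ j ⌋

count-singleton : ∀ {n} (i : Fin n) → count (singleton i) ≡ 1
count-singleton {suc n} zero    = cong suc (sum-replicate-zero n)
count-singleton {suc n} (suc i) = trans (sum-cong-≗ λ j → cong 𝟙 (step j)) (count-singleton i)
  where
  step : ∀ j → singleton (suc i) (suc j) ≡ singleton i j
  step j with i Fin.≟ j
  ... | yes _ = refl
  ... | no  _ = refl

count-remove : ∀ {n} (p : Fin n → Bool) {i} → T (p i) → count (p ─ singleton i) < count p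
count-remove p {i} pᵢ = subst (count (p ─ singleton i) <_) (sym (count-partition p (singleton i)))
  (+-monoˡ-≤ (count (p ─ singleton i))
    (count-pos (λ j → p j ∧ singleton i j) {i} (T-∧⁺ pᵢ (fromWitness {a? = i Fin.≟ i} refl))))

-- Sets of largest weight

argmax : ∀ {n} (p : Fin n → Bool) (w : Fin n → ℕ) → ∃ (T ∘ p) →
         ∃[ i ] T (p i) × (∀ j → T (p j) → w j ≤ w i)
argmax {suc n} p w ∃p with any? (T? ∘ p ∘ suc) | T? (p zero)
argmax p w (zero  , p₀) | no _    | no ¬p₀ = ⊥-elim (¬p₀ p₀)
argmax p w (suc i , pᵢ) | no ¬∃   | _      = ⊥-elim (¬∃ (i , pᵢ))
argmax p w _            | no ¬∃   | yes p₀ = zero , p₀ , λ where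
  zero    _  → ≤-refl
  (suc j) pⱼ → ⊥-elim (¬∃ (j , pⱼ))
argmax p w _            | yes ∃p′ | 0∈? with argmax (p ∘ suc) (w ∘ suc) ∃p′
... | i , pᵢ , max with 0∈? | w zero ≤? w (suc i)
...   | no ¬p₀ | _ = suc i , pᵢ , λ where
  zero    p₀ → ⊥-elim (¬p₀ p₀)
  (suc j) pⱼ → max j pⱼ
...   | yes _  | yes w₀≤ = suc i , pᵢ , λ where
  zero    _  → w₀≤
  (suc j) pⱼ → max j pⱼ
...   | yes p₀ | no  w₀≰ = zero , p₀ , λ where
  zero    _  → ≤-refl
  (suc j) pⱼ → ≤-trans (max j pⱼ) (<⇒≤ (≰⇒> w₀≰))

count-<⇒∃─ : ∀ {n} (p q : Fin n → Bool) → count p < count q → ∃[ i ] T ((q ─ p) i)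
count-<⇒∃─ p q p<q = 0<count⇒∃ (q ─ p) (+-cancelˡ-< (count p) 0 _ (begin-strict
  count p + 0                               ≡⟨ +-identityʳ _ ⟩
  count p                                   <⟨ p<q ⟩
  count q                                   ≡⟨ count-partition q p ⟩
  count (λ i → q i ∧ p i) + count (q ─ p)   ≤⟨ +-monoˡ-≤ _ (count-mono λ i → proj₂ ∘ T-∧⁻ {q i}) ⟩
  count p + count (q ─ p)                   ∎))
  where open ≤-Reasoning

-- Opaque because abstracting over a call of heaviest by with normalises it,
-- which is very slow for a literal k.
opaque
  heaviest : ∀ {n} (q : Fin n → Bool) (w : Fin n → ℕ) k → k ≤ count q →
             ∃[ p ] (∀ i → T (p i) → T (q i)) × count p ≡ k
                  × (∀ i j → T (p i) → T ((q ─ p) j) → w j ≤ w i)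
  heaviest {n} q w zero    _ = (λ _ → false) , (λ _ ()) , sum-replicate-zero n , λ _ _ ()
  heaviest {n} q w (suc k) k<q with heaviest q w k (<⇒≤ k<q)
  ... | p , p⊆q , refl , dominant with argmax (q ─ p) w (count-<⇒∃─ p q k<q)
  ...   | t , t∈q─p , max = p′ , p′⊆q , ∣p′∣≡1+k , dominant′
    where
    q∋t : T (q t)
    q∋t = proj₁ (T-∧⁻ {q t} t∈q─p)
    p∌t : T (not (p t))
    p∌t = proj₂ (T-∧⁻ {q t} t∈q─p)
    p′ : Fin n → Bool
    p′ i = p i ∨ singleton t i
    p′⁻ : ∀ i → T (p′ i) → T (p i) ⊎ t ≡ i
    p′⁻ i p′ᵢ = map₂ toWitness (Equivalence.to (T-∨ {p i}) p′ᵢ)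
    p′⊆q : ∀ i → T (p′ i) → T (q i)
    p′⊆q i p′ᵢ with p′⁻ i p′ᵢ
    ... | inj₁ pᵢ   = p⊆q i pᵢ
    ... | inj₂ refl = q∋t
    ∣p′∣≡1+k : count p′ ≡ suc (count p)
    ∣p′∣≡1+k = trans (count-disjoint-∨ p (singleton t) λ i pᵢ t≡i →
                       not-elim p∌t (subst (T ∘ p) (sym (toWitness t≡i)) pᵢ))
               (trans (cong (count p +_) (count-singleton t)) (+-comm (count p) 1))
    shrink : ∀ j → T ((q ─ p′) j) → T ((q ─ p) j)
    shrink j qⱼ with T-∧⁻ {q j} qⱼ
    ... | q∋j , p′∌j = T-∧⁺ {q j} q∋j (not-intro λ pⱼ →
                         not-elim p′∌j (Equivalence.from T-∨ (inj₁ pⱼ)))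
    dominant′ : ∀ i j → T (p′ i) → T ((q ─ p′) j) → w j ≤ w i
    dominant′ i j p′ᵢ qⱼ with p′⁻ i p′ᵢ
    ... | inj₁ pᵢ   = dominant i j pᵢ (shrink j qⱼ)
    ... | inj₂ refl = max j (shrink j qⱼ)

-- Resolving a graph by distinct codes

-- Choosing the value of t at each position of q so as to agree with at most
-- half of the surviving codes leaves none after count q positions.
avoid : ∀ {n N} (q : Fin n → Bool) (p : Fin N → Bool) (code : Fin N → Fin n → Bool) →
        count p < 2 ^ count q →
        Σ (Fin n → Bool) λ t → (∀ u → T (p u) → ∃[ w ] T (q w) × code u w ≢ t w)
avoid {zero}  q p code few = (λ ()) , λ u pᵤ → ⊥-elim (<-irrefl refl (≤-trans few (count-pos p pᵤ)))
avoid {suc n} q p code few with q zero in q₀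
... | false with t , differ ← avoid (q ∘ suc) p (λ u → code u ∘ suc) few =
  (λ { zero → false ; (suc w) → t w }) ,
  λ u pᵤ → let w , qw , ≢t = differ u pᵤ in suc w , qw , ≢t
... | true = choose (m<a+a⇒ (count p₁) (count p₀)
                       (subst₂ _<_ (count-partition p (λ u → code u zero))
                                   (cong (2 ^ count (q ∘ suc) +_) (+-identityʳ _)) few))
  where
  p₁ p₀ : _ → Bool
  p₁ u = p u ∧ code u zero
  p₀   = p ─ λ u → code u zero
  m<a+a⇒ : ∀ m k {a} → m + k < a + a → m < a ⊎ k < a
  m<a+a⇒ m k {a} lt with m <? a | k <? a
  ... | yes m<a | _       = inj₁ m<a
  ... | no  _   | yes k<a = inj₂ k<a
  ... | no  m≮a | no  k≮a = ⊥-elim (<⇒≱ lt (+-mono-≤ (≮⇒≥ m≮a) (≮⇒≥ k≮a)))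
  q∋0 : T (q zero)
  q∋0 = subst T (sym q₀) tt
  Avoids : (_ → Bool) → Set
  Avoids t = ∀ u → T (p u) → ∃[ w ] T (q w) × code u w ≢ t w
  -- The bit at `zero` takes a value shared by fewer than `2 ^ count (q ∘ suc)` of the codes; the
  -- other codes already differ from `t` there.
  choose : count p₁ < 2 ^ count (q ∘ suc) ⊎ count p₀ < 2 ^ count (q ∘ suc) → ∃ Avoids
  choose (inj₁ few₁) with t , differ ← avoid (q ∘ suc) p₁ (λ u → code u ∘ suc) few₁ =
    t⁺ , λ u pᵤ → avoids u pᵤ
    where
    t⁺ : _ → Bool
    t⁺ zero    = true
    t⁺ (suc w) = t w
    avoids : Avoids t⁺
    avoids u pᵤ with code u zero in c₀
    ... | false = zero , q∋0 , λ eq → subst T (trans (sym eq) c₀) tt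
    ... | true  with w , qw , ≢t ← differ u (T-∧⁺ {p u} pᵤ (subst T (sym c₀) tt)) = suc w , qw , ≢t
  choose (inj₂ few₀) with t , differ ← avoid (q ∘ suc) p₀ (λ u → code u ∘ suc) few₀ =
    t⁺ , λ u pᵤ → avoids u pᵤ
    where
    t⁺ : _ → Bool
    t⁺ zero    = false
    t⁺ (suc w) = t w
    avoids : Avoids t⁺
    avoids u pᵤ with code u zero in c₀
    ... | true  = zero , q∋0 , λ eq → subst T (trans (sym c₀) eq) tt
    ... | false with w , qw , ≢t ← differ u (T-∧⁺ {p u} pᵤ (not-intro (subst T c₀))) = suc w , qw , ≢t

-- G already forces the bits of the code of v at its neighbours in B, so
-- 2 ^ count (B ─ adj G v) codes remain for v.
Hall : ∀ {n} → Graph n → (B U : Fin n → Bool) → Set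
Hall G B U = ∀ P → (∀ i → T (P i) → T (U i)) → ∃ (T ∘ P) →
             ∃[ v ] T (P v) × count P ≤ 2 ^ count (B ─ adj G v)

module _ {n} (G : Graph n) (B : Fin n → Bool) where

  -- Edges are only added, so a bit of `code` can switch an adjacency on but never off.
  Separates : (Fin n → Fin n → Bool) → (Fin n → Bool) → Set
  Separates code U = ∀ u v → T (U u) → T (U v) → u ≢ v →
    ∃[ w ] T (B w) × (adj G u w ∨ code u w) ≢ (adj G v w ∨ code v w)

  -- The Hall condition at `P = U` supplies a vertex `v` with more admissible codes than `U` has
  -- other vertices. The others receive codes first, then `v` avoids them all. `k` is fuel for the
  -- recursion.
  separating-code : ∀ k U → count U ≤ k → Hall G B U → ∃[ code ] Separates code U
  separating-code zero    U ∣U∣≤0 hall =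
    (λ _ _ → false) , λ u v Uu _ _ → ⊥-elim (<⇒≱ (count-pos U Uu) ∣U∣≤0)
  separating-code (suc k) U ∣U∣≤1+k hall with any? (T? ∘ U)
  ... | no  ¬∃ = (λ _ _ → false) , λ u v Uu _ _ → ⊥-elim (¬∃ (u , Uu))
  ... | yes ∃U with hall U (λ _ Ui → Ui) ∃U
  ...   | v , v∈U , ∣U∣≤2^c
    with separating-code k (U ─ singleton v) (≤-pred (≤-trans (count-remove U v∈U) ∣U∣≤1+k))
           (λ P P⊆ → hall P λ i Pi → proj₁ (T-∧⁻ {U i} (P⊆ i Pi)))
  ...     | code , separates
    with avoid (B ─ adj G v) (U ─ singleton v) (λ u w → adj G u w ∨ code u w)
           (≤-trans (count-remove U v∈U) ∣U∣≤2^c)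
  ...       | t , avoids = (λ u w → if does (v Fin.≟ u) then t w else code u w) , sep
    where
    new : ∀ u → T (U u) → v ≢ u → ∃[ w ] T (B w) × (adj G u w ∨ code u w) ≢ (adj G v w ∨ t w)
    new u Uu v≢u with avoids u (T-∧⁺ {U u} Uu (not-intro (v≢u ∘ toWitness)))
    ... | w , q , differ with T-∧⁻ {B w} q
    -- Away from the neighbours of `v`, its new adjacency is exactly the chosen bit `t w`.
    ...   | Bw , v≁w = w , Bw , λ eq → differ (trans eq (absent (adj G v w) v≁w))
      where
      absent : ∀ a {b} → T (not a) → a ∨ b ≡ b
      absent false _ = refl
    sep : Separates (λ u w → if does (v Fin.≟ u) then t w else code u w) U
    sep u₁ u₂ U₁ U₂ u₁≢u₂ with v Fin.≟ u₁ | v Fin.≟ u₂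
    ... | yes refl | yes refl = ⊥-elim (u₁≢u₂ refl)
    ... | yes refl | no  v≢u₂ with w , Bw , differ ← new u₂ U₂ v≢u₂ = w , Bw , differ ∘ sym
    ... | no  v≢u₁ | yes refl = new u₁ U₁ v≢u₁
    ... | no  v≢u₁ | no  v≢u₂ = separates u₁ u₂ (T-∧⁺ {U u₁} U₁ (not-intro (v≢u₁ ∘ toWitness)))
                                                (T-∧⁺ {U u₂} U₂ (not-intro (v≢u₂ ∘ toWitness))) u₁≢u₂

  module _ (U : Fin n → Bool) (disjoint : ∀ i → T (U i) → ¬ T (B i)) (code : Fin n → Fin n → Bool) where

    new-edge : Fin n → Fin n → Bool
    new-edge u w = U u ∧ (B w ∧ code u w)

    new-edge-irrefl : ∀ {u} → ¬ T (new-edge u u)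
    new-edge-irrefl {u} e with T-∧⁻ {U u} e
    ... | Uu , e′ = disjoint u Uu (proj₁ (T-∧⁻ {B u} e′))

    add-codes : Graph n
    add-codes .adj u v = adj G u v ∨ (new-edge u v ∨ new-edge v u)
    add-codes .adj-sym {u} {v} e with Equivalence.to (T-∨ {adj G u v}) e
    ... | inj₁ e′ = Equivalence.from T-∨ (inj₁ (adj-sym G e′))
    ... | inj₂ e′ = Equivalence.from (T-∨ {adj G v u}) (inj₂ (subst T (∨-comm (new-edge u v) _) e′))
    add-codes .adj-irrefl {u} e with Equivalence.to (T-∨ {adj G u u}) e
    ... | inj₁ e′ = adj-irrefl G e′
    ... | inj₂ e′ with Equivalence.to (T-∨ {new-edge u u}) e′
    ...   | inj₁ e″ = new-edge-irrefl e″
    ...   | inj₂ e″ = new-edge-irrefl e″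

    -- The reversed term `new-edge w u` would put `u` into `B`, which is disjoint from `U`; so codes
    -- of different vertices do not interfere.
    add-codes-adj : ∀ {u w} → T (U u) → T (B w) → adj add-codes u w ≡ adj G u w ∨ code u w
    add-codes-adj {u} {w} Uu Bw = edge-value (adj G u w) (U w) (code w u) Uu Bw (disjoint u Uu)
      where
      edge-value : ∀ a f g {b c d e} → T b → T c → ¬ T d →
                   a ∨ ((b ∧ (c ∧ e)) ∨ (f ∧ (d ∧ g))) ≡ a ∨ e
      edge-value a f g {true} {true} {true}      _ _ ¬d = ⊥-elim (¬d tt)
      edge-value a f g {true} {true} {false} {e} _ _ _  =
        cong (a ∨_) (trans (cong (e ∨_) (∧-zeroʳ f)) (∨-identityʳ e))

-- Adjacency as distance one

T⇔⇒≡ : ∀ {a b} → (T a → T b) → (T b → T a) → a ≡ b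
T⇔⇒≡ {false} {false} _ _ = refl
T⇔⇒≡ {true}  {true}  _ _ = refl
T⇔⇒≡ {true}  {false} f _ = ⊥-elim (f tt)
T⇔⇒≡ {false} {true}  _ g = ⊥-elim (g tt)

findᵇ-sound : ∀ (p : ℕ → Bool) xs {k} → findᵇ p xs ≡ just k → T (p k)
findᵇ-sound p (x ∷ xs) eq with p x in px
findᵇ-sound p (x ∷ xs) refl | true  = subst T (sym px) tt
findᵇ-sound p (x ∷ xs) eq   | false = findᵇ-sound p xs eq

module _ {n} (G : Graph n) where

  walk-1⇒adj : ∀ {u v} → T (walk G 1 u v) → T (adj G u v)
  walk-1⇒adj {u} {v} w with Any.satisfied (any⁻ (λ x → adj G u x ∧ ⌊ x Fin.≟ v ⌋) (allFin n) w)
  ... | x , px with T-∧⁻ {adj G u x} px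
  ...   | e , x≡v = subst (T ∘ adj G u) (toWitness x≡v) e

  adj⇒walk-1 : ∀ {u v} → T (adj G u v) → T (walk G 1 u v)
  adj⇒walk-1 {u} {v} e = any⁺ (λ x → adj G u x ∧ ⌊ x Fin.≟ v ⌋)
    (lose (∈-allFin v) (T-∧⁺ e (fromWitness refl)))

  dist-refl : ∀ u → dist G u u ≡ just 0
  dist-refl u = go n u
    where
    go : ∀ m → Fin m → findᵇ (λ k → walk G k u u) (upTo m) ≡ just 0
    go (suc m) _ with u Fin.≟ u
    ... | yes _  = refl
    ... | no u≢u = ⊥-elim (u≢u refl)

  dist≡0⇒≡ : ∀ {u v} → dist G u v ≡ just 0 → u ≡ v
  dist≡0⇒≡ {u} {v} eq = toWitness (findᵇ-sound (λ k → walk G k u v) (upTo n) eq)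

  dist≡1⇒adj : ∀ {u v} → dist G u v ≡ just 1 → T (adj G u v)
  dist≡1⇒adj {u} {v} eq = walk-1⇒adj (findᵇ-sound (λ k → walk G k u v) (upTo n) eq)

  adj⇒dist≡1 : ∀ {u v} → T (adj G u v) → dist G u v ≡ just 1
  adj⇒dist≡1 {u} {v} e = go n u v u≢v
    where
    u≢v : u ≢ v
    u≢v refl = adj-irrefl G e
    -- The range `upTo m` has to reach 1; two distinct elements of `Fin m` rule out `m ≤ 1`.
    go : ∀ m → (x y : Fin m) → x ≢ y → findᵇ (λ k → walk G k u v) (upTo m) ≡ just 1
    go (suc zero)    zero zero x≢y = ⊥-elim (x≢y refl)
    go (suc (suc m)) _    _    _   with u Fin.≟ v
    ... | yes u≡v = ⊥-elim (u≢v u≡v)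
    ... | no  _   rewrite Equivalence.to T-≡ (adj⇒walk-1 e) = refl

  adj-separates-dist : ∀ {u v w} → adj G u w ≢ adj G v w → dist G u w ≢ dist G v w
  adj-separates-dist differ eq = differ (T⇔⇒≡
    (λ e → dist≡1⇒adj (trans (sym eq) (adj⇒dist≡1 e)))
    (λ e → dist≡1⇒adj (trans eq (adj⇒dist≡1 e))))

∣tabulate∣ : ∀ {n} (p : Fin n → Bool) → ∣ tabulate p ∣ ≡ count p
∣tabulate∣ {zero}  p = refl
∣tabulate∣ {suc n} p with p zero
... | true  = cong suc (∣tabulate∣ (p ∘ suc))
... | false = ∣tabulate∣ (p ∘ suc)

∈-tabulate⁺ : ∀ {n} {p : Fin n → Bool} {i} → T (p i) → i ∈ˢ tabulate p
∈-tabulate⁺ {p = p} {i} pᵢ = lookup⇒[]= i _ (trans (lookup∘tabulate p i) (Equivalence.to T-≡ pᵢ))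

-- β(H) ≤ k for some supergraph H of G, that is, τ(G) ≤ k.
ThresholdWitness : ∀ {n} → Graph n → ℕ → Set
ThresholdWitness G k = ∃[ H ] G ⊑ H × ∃[ W ] Resolving H W × ∣ W ∣ ≡ k

-- A vertex of `W` resolves itself from every other vertex by distance 0; two vertices outside `W`
-- are resolved by their codes in `B`. Vertices of `W` outside `B` need no code, which lets crowded
-- vertices be set aside.
Hall⇒threshold : ∀ {n} (G : Graph n) (W B : Fin n → Bool) → (∀ i → T (B i) → T (W i)) →
                 Hall G B (∁ W) → ThresholdWitness G (count W)
Hall⇒threshold {n} G W B B⊆W hall with separating-code G B n (∁ W)
  (≤-trans (m≤n+m _ (count W)) (≤-reflexive (count-∁ W))) hall
... | code , separates =
  H , (λ {u} {v} e → Equivalence.from (T-∨ {adj G u v}) (inj₁ e)) ,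
  tabulate W , resolving , ∣tabulate∣ W
  where
  disjoint : ∀ i → T (∁ W i) → ¬ T (B i)
  disjoint i i∉W i∈B = not-elim i∉W (B⊆W i i∈B)
  H = add-codes G B (∁ W) disjoint code
  resolving : Resolving H (tabulate W)
  resolving u v u≢v with T? (W u) | T? (W v)
  ... | yes u∈W | _       = u , ∈-tabulate⁺ u∈W , λ eq →
    u≢v (sym (dist≡0⇒≡ H (trans (sym eq) (dist-refl H u))))
  ... | no  _   | yes v∈W = v , ∈-tabulate⁺ v∈W , λ eq →
    u≢v (dist≡0⇒≡ H (trans eq (dist-refl H v)))
  ... | no  u∉W | no  v∉W with separates u v (not-intro u∉W) (not-intro v∉W) u≢v
  ...   | w , Bw , differ = w , ∈-tabulate⁺ (B⊆W w Bw) , adj-separates-dist H λ eq → differ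
          (trans (sym (add-codes-adj G B (∁ W) disjoint code (not-intro u∉W) Bw))
          (trans eq (add-codes-adj G B (∁ W) disjoint code (not-intro v∉W) Bw)))

-- Existence of the threshold dimension

findᵇ-cong : ∀ {p q : ℕ → Bool} → p ≗ q → findᵇ p ≗ findᵇ q
findᵇ-cong         p≗q []       = refl
findᵇ-cong {p} {q} p≗q (x ∷ xs) rewrite p≗q x with q x
... | true  = refl
... | false = findᵇ-cong p≗q xs

module _ {n} (G H : Graph n) (adj≡ : ∀ u v → adj G u v ≡ adj H u v) where

  walk-cong : ∀ k u v → walk G k u v ≡ walk H k u v
  walk-cong zero    u v = refl
  walk-cong (suc k) u v = cong or (map-cong (λ w → cong₂ _∧_ (adj≡ u w) (walk-cong k w v)) (allFin n))

  dist-cong : ∀ u v → dist G u v ≡ dist H u v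
  dist-cong u v = findᵇ-cong (λ k → walk-cong k u v) (upTo n)

  -- Graphs with the same adjacency need not be equal as records, so resolving sets are carried
  -- along pointwise equality.
  Resolving-resp : ∀ {W} → Resolving G W → Resolving H W
  Resolving-resp res u v u≢v with w , w∈W , differ ← res u v u≢v =
    w , w∈W , λ eq → differ (trans (dist-cong u w) (trans eq (sym (dist-cong v w))))

resolving? : ∀ {n} (G : Graph n) → Decidable (Resolving G)
resolving? G W = all? λ u → all? λ v → ¬? (u Fin.≟ v) →-dec
  any? λ w → (w ∈? W) ×-dec ¬? (Maybe.≡-dec _≟_ (dist G u w) (dist G v w))

module _ {n} (G : Graph n) where

  -- Symmetrised and stripped of loops, every set of ordered pairs is a legitimate set of edges to
  -- add. Supergraphs of `G` thus become subsets of a finite set, over which search is decidable.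
  link : Subset (n * n) → Fin n → Fin n → Bool
  link S u v = not ⌊ u Fin.≟ v ⌋ ∧ (lookup S (combine u v) ∨ lookup S (combine v u))

  add-links : Subset (n * n) → Graph n
  add-links S .adj u v = adj G u v ∨ link S u v
  add-links S .adj-sym {u} {v} e with Equivalence.to (T-∨ {adj G u v}) e
  ... | inj₁ e′ = Equivalence.from T-∨ (inj₁ (adj-sym G e′))
  ... | inj₂ e′ with T-∧⁻ {not ⌊ u Fin.≟ v ⌋} e′
  ...   | u≢v , l = Equivalence.from (T-∨ {adj G v u}) (inj₂
    (T-∧⁺ (not-intro λ v≡u → not-elim u≢v (fromWitness (sym (toWitness v≡u))))
          (subst T (∨-comm (lookup S (combine u v)) _) l)))
  add-links S .adj-irrefl {u} e with Equivalence.to (T-∨ {adj G u u}) e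
  ... | inj₁ e′ = adj-irrefl G e′
  ... | inj₂ e′ = not-elim (proj₁ (T-∧⁻ {not ⌊ u Fin.≟ u ⌋} e′)) (fromWitness refl)

  ⊑-add-links : ∀ S → G ⊑ add-links S
  ⊑-add-links S {u} {v} e = Equivalence.from (T-∨ {adj G u v}) (inj₁ e)

  links : Graph n → Subset (n * n)
  links H = tabulate (uncurry (adj H) ∘ remQuot n)

  lookup-links : ∀ H u v → lookup (links H) (combine u v) ≡ adj H u v
  lookup-links H u v = trans (lookup∘tabulate _ (combine u v)) (cong (uncurry (adj H)) (remQuot-combine u v))

  add-links-links : ∀ H → G ⊑ H → ∀ u v → adj H u v ≡ adj (add-links (links H)) u v
  add-links-links H G⊑H u v = T⇔⇒≡ to from
    where
    to : T (adj H u v) → T (adj (add-links (links H)) u v)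
    to e = Equivalence.from (T-∨ {adj G u v}) (inj₂ (T-∧⁺
      (not-intro λ u≡v → adj-irrefl H (subst (T ∘ adj H u) (sym (toWitness u≡v)) e))
      (Equivalence.from T-∨ (inj₁ (subst T (sym (lookup-links H u v)) e)))))
    from : T (adj (add-links (links H)) u v) → T (adj H u v)
    from e with Equivalence.to (T-∨ {adj G u v}) e
    ... | inj₁ e′ = G⊑H e′
    ... | inj₂ e′ with Equivalence.to (T-∨ {lookup (links H) (combine u v)})
                         (proj₂ (T-∧⁻ {not ⌊ u Fin.≟ v ⌋} e′))
    ...   | inj₁ l = subst T (lookup-links H u v) l
    ...   | inj₂ l = adj-sym H (subst T (lookup-links H v u) l)

  ResolvableWith : ℕ → Set
  ResolvableWith k = ∃[ S ] ∃[ W ] Resolving (add-links S) W × ∣ W ∣ ≡ k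

  resolvableWith? : Decidable ResolvableWith
  resolvableWith? k = anySubset? λ S → anySubset? λ W → resolving? (add-links S) W ×-dec (∣ W ∣ ≟ k)

  ThresholdWitness⇒ResolvableWith : ∀ {k} → ThresholdWitness G k → ResolvableWith k
  ThresholdWitness⇒ResolvableWith (H , G⊑H , W , res , ∣W∣≡k) =
    links H , W , Resolving-resp H (add-links (links H)) (add-links-links H G⊑H) res , ∣W∣≡k

  -- The least size of a resolving set over all supergraphs is also the metric dimension of the
  -- supergraph attaining it, since a smaller resolving set there would contradict minimality.
  thresholdDimension-exists : ∃ (ThresholdWitness G) →
    ∃[ τ ] ThresholdDimension G τ × (∀ k → ThresholdWitness G k → τ ≤ k)
  thresholdDimension-exists (k , wit)
    with least resolvableWith? (k , ThresholdWitness⇒ResolvableWith wit)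
  ... | τ , (S , W , res , ∣W∣≡τ) , min =
    τ , ((add-links S , (λ {u} {v} → ⊑-add-links S {u} {v}) , (W , res , ∣W∣≡τ) ,
         λ { k (W′ , res′ , ∣W′∣≡k) → min k (S , W′ , res′ , ∣W′∣≡k) }) ,
    λ { k (H , G⊑H , (W′ , res′ , ∣W′∣≡k) , _) →
        min k (ThresholdWitness⇒ResolvableWith (H , (λ {u} {v} → G⊑H {u} {v}) , W′ , res′ , ∣W′∣≡k)) }) ,
    λ k wit′ → min k (ThresholdWitness⇒ResolvableWith wit′)

-- The degree sum of a planar graph

locate : ∀ {n} (f : Fin n → ℕ) → Fin (sum f) → Σ (Fin n) (Fin ∘ f)
locate {suc n} f i with splitAt (f zero) i
... | inj₁ j = zero , j
... | inj₂ j with k , l ← locate (f ∘ suc) j = suc k , l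

index : ∀ {n} (f : Fin n → ℕ) → Σ (Fin n) (Fin ∘ f) → Fin (sum f)
index f (zero  , j) = j ↑ˡ sum (f ∘ suc)
index f (suc i , j) = f zero ↑ʳ index (f ∘ suc) (i , j)

index-locate : ∀ {n} (f : Fin n → ℕ) i → index f (locate f i) ≡ i
index-locate {suc n} f i with splitAt (f zero) i | join-splitAt (f zero) (sum (f ∘ suc)) i
... | inj₁ j | eq = eq
... | inj₂ j | eq = trans (cong (f zero ↑ʳ_) (index-locate (f ∘ suc) j)) eq

T⇒Fin : ∀ {b} → T b → Fin (𝟙 b)
T⇒Fin {true} _ = zero

Fin⇒T : ∀ {b} → Fin (𝟙 b) → T b
Fin⇒T {true} _ = _

T⇒Fin⇒T : ∀ {b} (i : Fin (𝟙 b)) → T⇒Fin (Fin⇒T {b} i) ≡ i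
T⇒Fin⇒T {true} zero = refl

degree : ∀ {n} → Graph n → Fin n → ℕ
degree G u = count (adj G u)

-- Darts and their orbits

module Class {A : Set} {R : Rel A 0ℓ} {k} (classes : Classes R k) where

  open Bijection classes public using ()
    renaming (to to class; injective to class-injective; cong to class-cong)

  rep : Fin k → A
  rep i = proj₁ (Bijection.strictlySurjective classes i)

  class-rep : ∀ i → class (rep i) ≡ i
  class-rep i = proj₂ (Bijection.strictlySurjective classes i)

  class-step : ∀ {x y} → R x y → class x ≡ class y
  class-step r = class-cong (EqClosure.return r)

module _ {n} {G : Graph n} where

  dart-≡ : {d e : Dart G} → source d ≡ source e → target d ≡ target e → d ≡ e
  dart-≡ {dart u v a} {dart u v b} refl refl = cong (dart u v) (T-irrelevant a b)

  _≟ᵈ_ : (d e : Dart G) → Dec (d ≡ e)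
  d ≟ᵈ e = map′ (uncurry dart-≡) (λ { refl → refl , refl })
    ((source d Fin.≟ source e) ×-dec (target d Fin.≟ target e))

  source≢target : (d : Dart G) → source d ≢ target d
  source≢target (dart u u e) refl = adj-irrefl G e

  reverse² : (d : Dart G) → reverse (reverse d) ≡ d
  reverse² d = dart-≡ refl refl

  edge-orbit : {d e : Dart G} → EqClosure (Maps reverse) d e → e ≡ d ⊎ e ≡ reverse d
  edge-orbit ε = inj₁ refl
  edge-orbit {d} (fwd refl ◅ path) with edge-orbit path
  ... | inj₁ e≡ = inj₂ e≡
  ... | inj₂ e≡ = inj₁ (trans e≡ (reverse² d))
  edge-orbit (_◅_ {j = c} (bwd refl) path) with edge-orbit path
  ... | inj₁ e≡ = inj₂ (trans e≡ (sym (reverse² c)))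
  ... | inj₂ e≡ = inj₁ e≡

  -- Tells the two darts of an edge apart, so that `E` edges carry at most `2 E` darts.
  orientation : Dart G → Fin 2
  orientation d = if toℕ (source d) <ᵇ toℕ (target d) then 0F else 1F

  orientation-reverse : (d : Dart G) → orientation d ≢ orientation (reverse d)
  orientation-reverse d eq with toℕ (source d) <ᵇ toℕ (target d) in s<t
                              | toℕ (target d) <ᵇ toℕ (source d) in t<s
  orientation-reverse d () | true  | false
  orientation-reverse d () | false | true
  ... | true  | true  = <-asym (<ᵇ⇒< (toℕ (source d)) _ (subst T (sym s<t) _))
                               (<ᵇ⇒< (toℕ (target d)) _ (subst T (sym t<s) _))
  ... | false | false = source≢target d (toℕ-injective (≤-antisym
    (≮⇒≥ λ lt → subst T t<s (<⇒<ᵇ lt)) (≮⇒≥ λ lt → subst T s<t (<⇒<ᵇ lt))))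

  -- Locating first a vertex in the degree sum, then a neighbour in its row, numbers the darts;
  -- injectivity makes bounds on darts into bounds on the degree sum.
  nth-dart : Fin (sum (degree G)) → Dart G
  nth-dart i with u , j ← locate (degree G) i with v , k ← locate (𝟙 ∘ adj G u) j =
    dart u v (Fin⇒T k)

  dart-index : Dart G → Fin (sum (degree G))
  dart-index (dart u v e) = index (degree G) (u , index (𝟙 ∘ adj G u) (v , T⇒Fin e))

  dart-index-nth : ∀ i → dart-index (nth-dart i) ≡ i
  dart-index-nth i with locate (degree G) i | index-locate (degree G) i
  ... | u , j | eqᵢ with locate (𝟙 ∘ adj G u) j | index-locate (𝟙 ∘ adj G u) j
  ...   | v , k | eqⱼ = trans (cong (λ l → index (degree G) (u , l))
    (trans (cong (λ m → index (𝟙 ∘ adj G u) (v , m)) (T⇒Fin⇒T k)) eqⱼ)) eqᵢ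

  nth-dart-injective : Injective _≡_ _≡_ nth-dart
  nth-dart-injective {i} {j} eq =
    trans (sym (dart-index-nth i)) (trans (cong dart-index eq) (dart-index-nth j))

module _ {n} {G : Graph n} (planar : Planar G) where

  open PlanarMap planar
  private
    module V = Class vertices
    module E = Class edges
    module F = Class faces
    module C = Class components

  source-face : ∀ d → source (face d) ≡ target d
  source-face d = next-source (reverse d)

  face≢ : ∀ d → face d ≢ d
  face≢ d eq = source≢target d (trans (sym (cong source eq)) (source-face d))

  -- Darts with a common source lie on one cycle of `next`, so representatives of different classes
  -- have different sources.
  V≤n : V ≤ n
  V≤n = injective⇒≤ {f = source ∘ V.rep} λ {i} {j} eq →
    trans (sym (V.class-rep i))
    (trans (V.class-cong (Star.map fwd (next-cyclic (V.rep i) (V.rep j) eq))) (V.class-rep j))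

  dart-code : Dart G → Fin (E * 2)
  dart-code d = combine (E.class d) (orientation d)

  dart-code-injective : Injective _≡_ _≡_ dart-code
  dart-code-injective {d} {e} eq
    with combine-injective (E.class d) (orientation d) (E.class e) (orientation e) eq
  ... | same-edge , same-orientation with edge-orbit (E.class-injective same-edge)
  ...   | inj₁ e≡d  = sym e≡d
  ...   | inj₂ refl = ⊥-elim (orientation-reverse d same-orientation)

  degree-sum≤2E : sum (degree G) ≤ E * 2
  degree-sum≤2E = injective⇒≤ {f = dart-code ∘ nth-dart} (nth-dart-injective ∘ dart-code-injective)

  Isolated : Dart G → Set
  Isolated d = next d ≡ d × next (reverse d) ≡ reverse d

  -- If the boundary closes after two darts, the second runs back between the same ends, so it is
  -- `reverse d` because the graph is simple. Then `next` fixes both darts: each end has degree one.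
  digon-isolated : ∀ {d} → face (face d) ≡ d → Isolated d
  digon-isolated {d} digon = next-d , face-d
    where
    face-d : face d ≡ reverse d
    face-d = dart-≡ (source-face d) (trans (sym (source-face (face d))) (cong source digon))
    next-d : next d ≡ d
    next-d = trans (cong next (sym (trans (cong reverse face-d) (reverse² d)))) digon

  isolated-reverse : ∀ {d} → Isolated d → Isolated (reverse d)
  isolated-reverse {d} (nd , nr) =
    nr , trans (cong next (reverse² d)) (trans nd (sym (reverse² d)))

  fixed-orbit : ∀ {d e} → next d ≡ d → Star (Maps next) d e → d ≡ e
  fixed-orbit nd ε             = refl
  fixed-orbit nd (refl ◅ path) = trans (sym nd) (fixed-orbit (cong next nd) path)

  -- The component of an isolated edge consists of its two darts, and `face` sends each to the
  -- other. Hence such a component determines its face.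
  isolated-component : ∀ {d e} → Isolated d →
                       EqClosure (λ d e → Maps next d e ⊎ Maps reverse d e) d e → F.class d ≡ F.class e
  isolated-component iso ε = refl
  isolated-component {d} (nd , nr) (fwd (inj₁ refl) ◅ path) =
    trans (cong F.class (sym nd)) (isolated-component (subst Isolated (sym nd) (nd , nr)) path)
  isolated-component {d} iso@(nd , nr) (fwd (inj₂ refl) ◅ path) =
    trans (F.class-step nr) (isolated-component (isolated-reverse iso) path)
  -- A predecessor `e` of `d` under `next` shares its source, so `next-cyclic` reaches `e` from `d`;
  -- as `d` is fixed, `e` is `d`.
  isolated-component {d} iso@(nd , nr) (_◅_ {j = e} (bwd (inj₁ ne≡d)) path)
    with fixed-orbit nd (next-cyclic d e (trans (sym (cong source ne≡d)) (next-source e)))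
  ... | refl = isolated-component iso path
  isolated-component {d} iso@(nd , nr) (_◅_ {j = e} (bwd (inj₂ re≡d)) path)
    with trans (sym (reverse² e)) (cong reverse re≡d)
  ... | refl = trans (F.class-step nr) (isolated-component (isolated-reverse iso) path)

  -- Every face claims three darts of its boundary; the face of an isolated
  -- edge has only two, and claims the component of the edge instead.
  claim : Fin F → Fin 3 → Dart G ⊎ Fin C
  claim i 0F = inj₁ (F.rep i)
  claim i 1F = inj₁ (face (F.rep i))
  claim i 2F with face (face (F.rep i)) ≟ᵈ F.rep i
  ... | yes _ = inj₂ (C.class (F.rep i))
  ... | no  _ = inj₁ (face (face (F.rep i)))

  class-face : ∀ d → F.class (face d) ≡ F.class d
  class-face d = sym (F.class-step refl)

  claim-dart : ∀ i a {d} → claim i a ≡ inj₁ d → F.class d ≡ i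
  claim-dart i 0F refl = F.class-rep i
  claim-dart i 1F refl = trans (class-face _) (F.class-rep i)
  claim-dart i 2F eq with face (face (F.rep i)) ≟ᵈ F.rep i
  claim-dart i 2F refl | no _ = trans (class-face _) (trans (class-face _) (F.class-rep i))

  claim-component : ∀ i a {c} → claim i a ≡ inj₂ c →
                    a ≡ 2F × Isolated (F.rep i) × c ≡ C.class (F.rep i)
  claim-component i 2F eq with face (face (F.rep i)) ≟ᵈ F.rep i
  claim-component i 2F refl | yes digon = refl , digon-isolated digon , refl

  -- Consecutive darts of a face differ because there are no loops; the first and third differ
  -- unless the face is a digon, and then the third claim is a component.
  claim-injectiveʳ : ∀ i a b → claim i a ≡ claim i b → a ≡ b
  claim-injectiveʳ i 0F 0F eq = refl
  claim-injectiveʳ i 0F 1F eq = ⊥-elim (face≢ _ (sym (inj₁-injective eq)))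
  claim-injectiveʳ i 0F 2F eq with face (face (F.rep i)) ≟ᵈ F.rep i
  ... | no ≢rep = ⊥-elim (≢rep (sym (inj₁-injective eq)))
  claim-injectiveʳ i 1F 0F eq = ⊥-elim (face≢ _ (inj₁-injective eq))
  claim-injectiveʳ i 1F 1F eq = refl
  claim-injectiveʳ i 1F 2F eq with face (face (F.rep i)) ≟ᵈ F.rep i
  ... | no _ = ⊥-elim (face≢ _ (sym (inj₁-injective eq)))
  claim-injectiveʳ i 2F 0F eq with face (face (F.rep i)) ≟ᵈ F.rep i
  ... | no ≢rep = ⊥-elim (≢rep (inj₁-injective eq))
  claim-injectiveʳ i 2F 1F eq with face (face (F.rep i)) ≟ᵈ F.rep i
  ... | no _ = ⊥-elim (face≢ _ (inj₁-injective eq))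
  claim-injectiveʳ i 2F 2F eq = refl

  -- A claimed dart lies on the claiming face, and a claimed component has only one face.
  claim-injective : ∀ i a j b → claim i a ≡ claim j b → i ≡ j × a ≡ b
  claim-injective i a j b eq with claim i a in eqᵢ
  ... | inj₁ d with trans (sym (claim-dart i a eqᵢ)) (claim-dart j b (sym eq))
  ...   | refl = refl , claim-injectiveʳ i a b (trans eqᵢ eq)
  claim-injective i a j b eq | inj₂ c
    with claim-component i a eqᵢ | claim-component j b (sym eq)
  ... | refl , isoᵢ , c≡ᵢ | refl , isoⱼ , c≡ⱼ =
    trans (sym (F.class-rep i))
    (trans (isolated-component isoᵢ (C.class-injective (trans (sym c≡ᵢ) c≡ⱼ))) (F.class-rep j)) , refl

  3F≤2E+C : F * 3 ≤ E * 2 + C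
  3F≤2E+C = injective⇒≤ {f = code} λ {x} {y} eq →
    let i , a = remQuot {F} 3 x ; j , b = remQuot {F} 3 y
        i≡j , a≡b = claim-injective i a j b (map₁-injective (claim i a) (claim j b) (join-injective _ _ eq))
    in trans (sym (combine-remQuot {F} 3 x)) (trans (cong₂ combine i≡j a≡b) (combine-remQuot {F} 3 y))
    where
    code : Fin (F * 3) → Fin (E * 2 + C)
    code x = join (E * 2) C (map₁ dart-code (uncurry claim (remQuot {F} 3 x)))
    join-injective : ∀ s t → join (E * 2) C s ≡ join (E * 2) C t → s ≡ t
    join-injective s t eq =
      trans (sym (splitAt-join (E * 2) C s)) (trans (cong (splitAt (E * 2)) eq) (splitAt-join (E * 2) C t))
    map₁-injective : ∀ s t → map₁ dart-code s ≡ map₁ dart-code t → s ≡ t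
    map₁-injective (inj₁ d) (inj₁ e) eq   = cong inj₁ (dart-code-injective (inj₁-injective eq))
    map₁-injective (inj₂ c) (inj₂ .c) refl = refl

  -- Tripling Euler's formula and inserting `3 F ≤ 2 E + C` and `V ≤ n` gives `E + 5 C ≤ 3 n`; this
  -- is then doubled.
  degree-sum+10C≤6n : sum (degree G) + 10 * C ≤ 6 * n
  degree-sum+10C≤6n = begin
    sum (degree G) + 10 * C   ≤⟨ +-monoˡ-≤ (10 * C) degree-sum≤2E ⟩
    E * 2 + 10 * C            ≡⟨ double E C ⟩
    2 * (E + 5 * C)           ≤⟨ *-monoʳ-≤ 2 E+5C≤3n ⟩
    2 * (3 * n)               ≡⟨ sym (*-assoc 2 3 n) ⟩
    6 * n                     ∎
    where
    open ≤-Reasoning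
    double : ∀ e c → e * 2 + 10 * c ≡ 2 * (e + 5 * c)
    double = solve-∀
    regroup : ∀ e c → (e * 2 + c) + (e + 5 * c) ≡ 3 * (e + 2 * c)
    regroup = solve-∀
    regroup′ : ∀ v f → 3 * (v + f) ≡ f * 3 + 3 * v
    regroup′ = solve-∀
    E+5C≤3n : E + 5 * C ≤ 3 * n
    E+5C≤3n = +-cancelˡ-≤ (E * 2 + C) _ _ (begin
      (E * 2 + C) + (E + 5 * C)  ≡⟨ regroup E C ⟩
      3 * (E + 2 * C)            ≡⟨ cong (3 *_) (sym euler) ⟩
      3 * (V + F)                ≡⟨ regroup′ V F ⟩
      F * 3 + 3 * V              ≤⟨ +-mono-≤ 3F≤2E+C (*-monoʳ-≤ 3 V≤n) ⟩
      (E * 2 + C) + 3 * n        ∎)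

  -- A nonzero degree sum yields a dart, and that dart has a component, so `C ≥ 1`.
  planar-degree-sum : sum (degree G) ≡ 0 ⊎ sum (degree G) + 10 ≤ 6 * n
  planar-degree-sum with sum (degree G) in S | nth-dart {G = G} | degree-sum+10C≤6n
  ... | zero  | _   | _     = inj₁ refl
  ... | suc s | nth | bound = inj₂ (≤-trans (+-monoʳ-≤ (suc s) (10≤10C (C.class (nth zero)))) bound)
    where
    10≤10C : ∀ {c} → Fin c → 10 ≤ 10 * c
    10≤10C {suc c} _ = *-monoʳ-≤ 10 (s≤s (z≤n {c}))

-- The choice of W

module _ {n} (G : Graph n) where

  degreeIn : (Fin n → Bool) → Fin n → ℕ
  degreeIn B v = count (λ w → B w ∧ adj G v w)

  degreeIn≤degree : ∀ B v → degreeIn B v ≤ degree G v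
  degreeIn≤degree B v = count-mono λ w → proj₂ ∘ T-∧⁻ {B w}

  -- `j` bounds the number of non-neighbours in `B` of each vertex of `P`, that is, the number of
  -- free bits of its code.
  Uncrowded : (B U : Fin n → Bool) → Set
  Uncrowded B U = ∀ P j → (∀ i → T (P i) → T (U i)) → ∃ (T ∘ P) →
    (∀ i → T (P i) → count B ≤ degreeIn B i + j) → ¬ 2 ^ j < count P

  -- The vertex of `P` with the most free bits serves as `v`, and its number of free bits as `j`.
  Hall-intro : ∀ B U → Uncrowded B U → Hall G B U
  Hall-intro B U small P P⊆U ∃P with argmax P (λ v → count (B ─ adj G v)) ∃P
  ... | v , Pv , max = v , Pv , ≮⇒≥ (small P (count (B ─ adj G v)) P⊆U ∃P λ i Pi →
    ≤-trans (≤-reflexive (count-partition B (adj G i))) (+-monoʳ-≤ (degreeIn B i) (max i Pi)))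

  -- Double counting of the darts that end in `B`.
  ∑degreeIn : ∀ B → sum (degreeIn B) ≡ sum (λ w → 𝟙 (B w) * degree G w)
  ∑degreeIn B = begin
    sum (λ v → sum λ w → 𝟙 (B w ∧ adj G v w))
      ≡⟨ ∑-comm (λ v w → 𝟙 (B w ∧ adj G v w)) ⟩
    sum (λ w → sum λ v → 𝟙 (B w ∧ adj G v w))
      ≡⟨ (sum-cong-≗ λ w → sum-cong-≗ λ v → incidence (B w) w v) ⟩
    sum (λ w → sum λ v → 𝟙 (B w) * 𝟙 (adj G w v))
      ≡⟨ (sum-cong-≗ λ w → sym (*-distribˡ-sum (𝟙 (B w)) (𝟙 ∘ adj G w))) ⟩
    sum (λ w → 𝟙 (B w) * degree G w)                ∎
    where
    open ≡-Reasoning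
    incidence : ∀ b w v → 𝟙 (b ∧ adj G v w) ≡ 𝟙 b * 𝟙 (adj G w v)
    incidence false w v = refl
    incidence true  w v = trans (cong 𝟙 (T⇔⇒≡ (adj-sym G) (adj-sym G))) (sym (+-identityʳ _))

  threshold-full : ThresholdWitness G n
  threshold-full = subst (ThresholdWitness G) (count-full n)
    (Hall⇒threshold G full full (λ _ _ → _) λ P P⊆∅ (i , Pi) → ⊥-elim (P⊆∅ i Pi))

  threshold-top : ∀ k → k ≤ n →
    (∀ W → count W ≡ k → (∀ i j → T (W i) → T (∁ W j) → degree G j ≤ degree G i) →
       Uncrowded W (∁ W)) →
    ThresholdWitness G k
  threshold-top k k≤n uncrowded
    with heaviest full (degree G) k (≤-trans k≤n (≤-reflexive (sym (count-full n))))
  ... | W , _ , refl , dominant =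
    Hall⇒threshold G W W (λ _ Wi → Wi) (Hall-intro W (∁ W) (uncrowded W refl dominant))

count-outside : ∀ {n} (W P : Fin n → Bool) → (∀ i → T (P i) → T (∁ W i)) → count W + count P ≤ n
count-outside W P P⊆∁W = ≤-trans (+-monoʳ-≤ (count W) (count-mono P⊆∁W)) (≤-reflexive (count-∁ W))

-- With a single vertex outside `W`, no `P` has more than one element. This serves the logarithmic
-- bound at order 4.
threshold-pred : ∀ {n} (G : Graph (suc n)) → ThresholdWitness G n
threshold-pred {n} G = threshold-top G n (n≤1+n n) λ W ∣W∣≡n _ P j P⊆∁W _ _ 2^j<∣P∣ →
  <⇒≱ 2^j<∣P∣ (≤-trans (+-cancelˡ-≤ n _ 1 (one-left W ∣W∣≡n P P⊆∁W)) (m^n>0 2 j))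
  where
  one-left : ∀ W → count W ≡ n → ∀ P → (∀ i → T (P i) → T (∁ W i)) → n + count P ≤ n + 1
  one-left W ∣W∣≡n P P⊆∁W = ≤-trans (subst (λ w → w + count P ≤ suc n) ∣W∣≡n (count-outside W P P⊆∁W))
                                    (≤-reflexive (+-comm 1 n))

-- Here `p` is the size of `P`, and all `7 + p` vertices of `W ∪ P` have degree at least `7 - j`.
-- The degree sum would be at least 9 · 7 for `j = 0` and 10 · 6 for `j = 1`; for larger `j`,
-- `2 ^ j` is already at least 4.
seven-top-contradiction : ∀ j {p} → (7 + p) * (7 ∸ j) ≤ 56 → p ≤ 4 → ¬ 2 ^ j < p
seven-top-contradiction 0 {p} bound _ 2≤p =
  <⇒≱ (<ᵇ⇒< 56 63 _) (≤-trans {63} {(7 + p) * 7} (*-monoˡ-≤ 7 {9} {7 + p} (+-monoʳ-≤ 7 2≤p)) bound)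
seven-top-contradiction 1 {p} bound _ 3≤p =
  <⇒≱ (<ᵇ⇒< 56 60 _) (≤-trans {60} {(7 + p) * 6} (*-monoˡ-≤ 6 {10} {7 + p} (+-monoʳ-≤ 7 3≤p)) bound)
seven-top-contradiction (suc (suc j)) _ p≤4 2^j<p =
  <⇒≱ 2^j<p (≤-trans p≤4 (^-monoʳ-≤ 2 {2} {2 + j} (s≤s (s≤s z≤n))))

threshold-small : ∀ {n} (G : Graph n) → 7 ≤ n → n < 12 → sum (degree G) ≤ 56 → ThresholdWitness G 7
threshold-small {n} G 7≤n n<12 S≤56 = threshold-top G 7 7≤n uncrowded
  where
  uncrowded : ∀ W → count W ≡ 7 → (∀ i j → T (W i) → T (∁ W j) → degree G j ≤ degree G i) →
              Uncrowded G W (∁ W)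
  uncrowded W ∣W∣≡7 dominant P j P⊆∁W (v , Pv) dense 2^j<∣P∣ =
    seven-top-contradiction j degree-bound ∣P∣≤4 2^j<∣P∣
    where
    ∣P∣≤4 : count P ≤ 4
    ∣P∣≤4 = +-cancelˡ-≤ 7 _ _ (≤-trans
      (subst (λ w → w + count P ≤ n) ∣W∣≡7 (count-outside W P P⊆∁W)) (≤-pred n<12))
    dense-P : ∀ i → T (P i) → 7 ∸ j ≤ degree G i
    dense-P i Pi = ≤-trans (m≤n+o⇒m∸n≤o 7 j (subst₂ _≤_ ∣W∣≡7 (+-comm _ j) (dense i Pi)))
                           (degreeIn≤degree G W i)
    dense-W∪P : ∀ i → T (W i ∨ P i) → 7 ∸ j ≤ degree G i
    dense-W∪P i Wi∨Pi with Equivalence.to (T-∨ {W i}) Wi∨Pi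
    -- `v` lies outside `W`, so each vertex of `W` has at least its degree.
    ... | inj₁ Wi = ≤-trans (dense-P v Pv) (dominant i v Wi (P⊆∁W v Pv))
    ... | inj₂ Pi = dense-P i Pi
    degree-bound : (7 + count P) * (7 ∸ j) ≤ 56
    degree-bound = ≤-trans (subst (λ c → c * (7 ∸ j) ≤ sum (degree G))
      (trans (count-disjoint-∨ W P λ i Wi Pi → not-elim (P⊆∁W i Pi) Wi) (cong (_+ count P) ∣W∣≡7))
      (count-*-≤-sum (λ i → W i ∨ P i) dense-W∪P)) S≤56

-- The case `d ≥ 2`, with `e = d - 2`

1+n≤2^n : ∀ n → suc n ≤ 2 ^ n
1+n≤2^n zero    = ≤-refl
1+n≤2^n (suc n) = begin
  1 + suc n       ≤⟨ +-mono-≤ (m^n>0 2 n) (1+n≤2^n n) ⟩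
  2 ^ n + 2 ^ n   ≡⟨ cong (_+_ (2 ^ n)) (+-identityʳ _) ⟨
  2 ^ suc n       ∎
  where open ≤-Reasoning

-- Here `7 + 4 * e` is the size `4 d - 1` of `B` and `m` that of `P`. Equality occurs at `j = 0`,
-- `m = 2`, which is why the degree sum in `B` must be strictly below `6 |B|`. The bound on `j`
-- keeps `|B| - j` at least 4.
codes-inequality : ∀ e j {m} → j ≤ 3 + e → 2 ^ j < m → 6 * (7 + 4 * e) ≤ (4 + m) * (7 + 4 * e ∸ j)
codes-inequality e zero          {m} _ 2^j<m = *-monoˡ-≤ (7 + 4 * e) (+-monoʳ-≤ 4 2^j<m)
codes-inequality e (suc zero)    {m} _ 2^j<m = begin
  6 * (7 + 4 * e)              ≤⟨ m≤m+n _ (4 * e) ⟩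
  6 * (7 + 4 * e) + 4 * e      ≡⟨ expand e ⟩
  7 * (6 + 4 * e)              ≤⟨ *-monoˡ-≤ (6 + 4 * e) (+-monoʳ-≤ 4 2^j<m) ⟩
  (4 + m) * (6 + 4 * e)        ∎
  where
  open ≤-Reasoning
  expand : ∀ e → 6 * (7 + 4 * e) + 4 * e ≡ 7 * (6 + 4 * e)
  expand = solve-∀
codes-inequality e (suc (suc i)) {m} (s≤s (s≤s i≤1+e)) 2^j<m = begin
  6 * (7 + 4 * e)              ≡⟨ cong (6 *_) x≡j+y ⟩
  6 * (2 + i + y)              ≤⟨ m≤m+n _ (10 * i) ⟩
  6 * (2 + i + y) + 10 * i     ≡⟨ expand i y ⟩
  (3 + 4 * i) * 4 + 6 * y      ≤⟨ +-monoˡ-≤ (6 * y) (*-monoʳ-≤ (3 + 4 * i) 4≤y) ⟩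
  (3 + 4 * i) * y + 6 * y      ≡⟨ collect i y ⟩
  (5 + 4 * (1 + i)) * y        ≤⟨ *-monoˡ-≤ y (+-monoʳ-≤ 5 4[1+i]≤2^j) ⟩
  (4 + suc (2 ^ (2 + i))) * y  ≤⟨ *-monoˡ-≤ y (+-monoʳ-≤ 4 2^j<m) ⟩
  (4 + m) * y                  ∎
  where
  open ≤-Reasoning
  y = 5 + 4 * e ∸ i
  expand : ∀ i y → 6 * (2 + i + y) + 10 * i ≡ (3 + 4 * i) * 4 + 6 * y
  expand = solve-∀
  collect : ∀ i y → (3 + 4 * i) * y + 6 * y ≡ (5 + 4 * (1 + i)) * y
  collect = solve-∀
  split-x : ∀ e → 5 + 4 * e ≡ 4 + (1 + e) + 3 * e
  split-x = solve-∀
  4+i≤ : 4 + i ≤ 5 + 4 * e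
  4+i≤ = ≤-trans (+-monoʳ-≤ 4 i≤1+e) (≤-trans (m≤m+n _ (3 * e)) (≤-reflexive (sym (split-x e))))
  4≤y : 4 ≤ y
  4≤y = m+n≤o⇒m≤o∸n 4 4+i≤
  x≡j+y : 7 + 4 * e ≡ 2 + i + y
  x≡j+y = cong (_+_ 2) (sym (m+[n∸m]≡n (≤-trans (m≤n+m i 4) 4+i≤)))
  4[1+i]≤2^j : 4 * (1 + i) ≤ 2 ^ (2 + i)
  4[1+i]≤2^j = ≤-trans (*-monoʳ-≤ 4 (1+n≤2^n i)) (≤-reflexive (*-assoc 2 2 (2 ^ i)))

-- Either all degrees in `B` are at most 5, or some vertex of `B` has degree at least 6. In the
-- latter case so do all vertices outside `B`, and they use up 6 each of a total below `6 n`.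
∑degree-lightest : ∀ {n} (G : Graph n) B → (∀ i j → T (B i) → T (∁ B j) → degree G i ≤ degree G j) →
  0 < count B → sum (degree G) < 6 * n → sum (degreeIn G B) < 6 * count B
∑degree-lightest {n} G B light B≢∅ S<6n with any? (λ i → T? (B i) ×-dec (6 ≤? degree G i))
... | no  ¬heavy = begin-strict
  sum (degreeIn G B)                    ≡⟨ ∑degreeIn G B ⟩
  sum (λ w → 𝟙 (B w) * degree G w)
    ≤⟨ sum-mono-≤ (λ w → at-most-5 (B w) λ Bw → ≤-pred (≰⇒> λ 6≤ → ¬heavy (w , Bw , 6≤))) ⟩
  sum (λ w → 𝟙 (B w) * 5)               ≡⟨ *-distribʳ-sum 5 (𝟙 ∘ B) ⟨
  count B * 5                           ≡⟨ *-comm (count B) 5 ⟩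
  5 * count B                           <⟨ *-monoˡ-< (count B) ⦃ >-nonZero B≢∅ ⦄ {5} {6} ≤-refl ⟩
  6 * count B                           ∎
  where
  open ≤-Reasoning
  at-most-5 : ∀ b {k} → (T b → k ≤ 5) → 𝟙 b * k ≤ 𝟙 b * 5
  at-most-5 false _ = z≤n
  at-most-5 true  h = *-monoʳ-≤ 1 (h _)
... | yes (v , Bv , 6≤deg) = +-cancelʳ-< (count (∁ B) * 6) _ _ (begin-strict
  sum (degreeIn G B) + count (∁ B) * 6
    ≡⟨ cong₂ _+_ (∑degreeIn G B) (*-distribʳ-sum 6 (𝟙 ∘ ∁ B)) ⟩
  sum (λ w → 𝟙 (B w) * degree G w) + sum (λ w → 𝟙 (∁ B w) * 6)
    ≡⟨ ∑-distrib-+ (λ w → 𝟙 (B w) * degree G w) (λ w → 𝟙 (∁ B w) * 6) ⟨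
  sum (λ w → 𝟙 (B w) * degree G w + 𝟙 (∁ B w) * 6)
    ≤⟨ sum-mono-≤ (λ w → at-least-6 (B w) λ ∁Bw → ≤-trans 6≤deg (light v w Bv ∁Bw)) ⟩
  sum (degree G)
    <⟨ S<6n ⟩
  6 * n
    ≡⟨ cong (6 *_) (count-∁ B) ⟨
  6 * (count B + count (∁ B))
    ≡⟨ *-distribˡ-+ 6 (count B) (count (∁ B)) ⟩
  6 * count B + 6 * count (∁ B)
    ≡⟨ cong (_+_ (6 * count B)) (*-comm 6 (count (∁ B))) ⟩
  6 * count B + count (∁ B) * 6 ∎)
  where
  open ≤-Reasoning
  at-least-6 : ∀ b {k} → (T (not b) → 6 ≤ k) → 𝟙 b * k + 𝟙 (not b) * 6 ≤ k
  at-least-6 true  {k} _ = ≤-reflexive (trans (+-identityʳ _) (+-identityʳ k))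
  at-least-6 false     h = h _

-- This is where the definition of `f` enters: `n < 4 (2 ^ d + d)` leaves fewer than `2 ^ (d + 2)`
-- vertices outside `W`, so `2 ^ j < |P|` forces `j ≤ d + 1`.
outside-small : ∀ e {p n} → 11 + 4 * e + p ≤ n → n < (2 ^ (2 + e) + (2 + e)) * 4 → p < 2 ^ (4 + e)
outside-small e {p} {n} ≤n n< = +-cancelʳ-< (8 + 4 * e) p (2 ^ (4 + e)) (begin-strict
  p + (8 + 4 * e)               ≤⟨ +-monoʳ-≤ p (m≤n+m (8 + 4 * e) 3) ⟩
  p + (11 + 4 * e)              ≡⟨ +-comm p _ ⟩
  11 + 4 * e + p                ≤⟨ ≤n ⟩
  n                             <⟨ n< ⟩
  (2 ^ (2 + e) + (2 + e)) * 4   ≡⟨ expand (2 ^ e) e ⟩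
  2 ^ (4 + e) + (8 + 4 * e)     ∎)
  where
  open ≤-Reasoning
  expand : ∀ p e → (2 * (2 * p) + (2 + e)) * 4 ≡ 2 * (2 * (2 * (2 * p))) + (8 + 4 * e)
  expand = solve-∀

-- The lightest `x` vertices are obtained as the complement `B` of the `n ∸ x` heaviest, `C`. Inside
-- `C`, the set `A` of four is chosen by a different weight, the number of neighbours in `B`.
threshold-large : ∀ {n} (G : Graph n) e x → x ≡ 7 + 4 * e → 4 + x ≤ n →
                  n < (2 ^ (2 + e) + (2 + e)) * 4 →
                  sum (degree G) < 6 * n → ThresholdWitness G (4 + x)
threshold-large {n} G e x x≡ b≤n n< S<6n
  with heaviest full (degree G) (n ∸ x) (≤-trans (m∸n≤m n x) (≤-reflexive (sym (count-full n))))
... | C , _ , ∣C∣≡ , C-heavy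
  with heaviest C (degreeIn G (∁ C)) 4
         (≤-trans (m+n≤o⇒m≤o∸n 4 b≤n) (≤-reflexive (sym ∣C∣≡)))
... | A , A⊆C , ∣A∣≡4 , A-heavy = subst (ThresholdWitness G) ∣W∣≡ (Hall⇒threshold G W B
    (λ i Bi → Equivalence.from (T-∨ {A i}) (inj₂ Bi)) (Hall-intro G B (∁ W) uncrowded))
  where
  B W : Fin n → Bool
  B   = ∁ C
  W i = A i ∨ B i
  x≤n : x ≤ n
  x≤n = ≤-trans (m≤n+m x 4) b≤n
  ∣B∣≡x : count B ≡ x
  ∣B∣≡x = +-cancelˡ-≡ (n ∸ x) _ _ (trans (cong (_+ count B) (sym ∣C∣≡))
    (trans (count-∁ C) (sym (m∸n+n≡m x≤n))))
  ∣W∣≡ : count W ≡ 4 + x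
  ∣W∣≡ = trans (count-disjoint-∨ A B λ i Ai Bi → not-elim Bi (A⊆C i Ai))
               (cong₂ _+_ ∣A∣≡4 ∣B∣≡x)
  D<6x : sum (degreeIn G B) < 6 * x
  D<6x = subst (λ b → sum (degreeIn G B) < 6 * b) ∣B∣≡x (∑degree-lightest G B
    (λ i j Bi ∁Bj → C-heavy j i (¬¬ ∁Bj) Bi) (subst (0 <_) (sym (trans ∣B∣≡x x≡)) z<s) S<6n)
    where
    ¬¬ : ∀ {b} → T (not (not b)) → T b
    ¬¬ {true} _ = _
  uncrowded : Uncrowded G B (∁ W)
  uncrowded P j P⊆∁W (v , Pv) dense 2^j<∣P∣ = <⇒≱ D<6x (begin
    6 * x
      ≤⟨ subst (λ x → 6 * x ≤ (4 + count P) * (x ∸ j)) (sym x≡)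
           (codes-inequality e j {count P} j≤3+e 2^j<∣P∣) ⟩
    (4 + count P) * (x ∸ j)
      ≡⟨ cong (λ a → (a + count P) * (x ∸ j)) ∣A∣≡4 ⟨
    (count A + count P) * (x ∸ j)
      ≡⟨ cong (_* (x ∸ j)) (count-disjoint-∨ A P λ i Ai Pi →
           not-elim (P⊆∁W i Pi) (Equivalence.from T-∨ (inj₁ Ai))) ⟨
    count (λ i → A i ∨ P i) * (x ∸ j)
      ≤⟨ count-*-≤-sum (λ i → A i ∨ P i) dense-A∪P ⟩
    sum (degreeIn G B)       ∎)
    where
    open ≤-Reasoning
    dense-P : ∀ i → T (P i) → x ∸ j ≤ degreeIn G B i
    dense-P i Pi = m≤n+o⇒m∸n≤o x j (subst₂ _≤_ ∣B∣≡x (+-comm _ j) (dense i Pi))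
    P⊆C─A : ∀ i → T (P i) → T ((C ─ A) i)
    P⊆C─A i Pi with P⊆∁W i Pi
    ... | ∁Wi = T-∧⁺ (¬B⇒C (C i) λ Bi → not-elim ∁Wi (Equivalence.from (T-∨ {A i}) (inj₂ Bi)))
                     (not-intro λ Ai → not-elim ∁Wi (Equivalence.from T-∨ (inj₁ Ai)))
      where
      ¬B⇒C : ∀ c → ¬ T (not c) → T c
      ¬B⇒C true  _  = _
      ¬B⇒C false ¬c = ⊥-elim (¬c _)
    dense-A∪P : ∀ i → T (A i ∨ P i) → x ∸ j ≤ degreeIn G B i
    dense-A∪P i Ai∨Pi with Equivalence.to (T-∨ {A i}) Ai∨Pi
    -- `v` was left behind in `C ─ A`, so no vertex of `A` has fewer neighbours in `B`.
    ... | inj₁ Ai = ≤-trans (dense-P v Pv) (A-heavy i v Ai (P⊆C─A v Pv))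
    ... | inj₂ Pi = dense-P i Pi
    ∣P∣<2^ : count P < 2 ^ (4 + e)
    ∣P∣<2^ = outside-small e {count P}
      (subst (λ w → w + count P ≤ n) (trans ∣W∣≡ (cong (_+_ 4) x≡)) (count-outside W P P⊆∁W)) n<
    j≤3+e : j ≤ 3 + e
    j≤3+e = ≮⇒≥ λ 3+e<j → <-asym ∣P∣<2^ (≤-trans (s≤s (^-monoʳ-≤ 2 3+e<j)) 2^j<∣P∣)

-- When `n` is within the bound, all vertices together serve as `W`; this covers `d = 0`, where
-- `n < 4`.
threshold-bound : ∀ {n} (G : Graph n) → Planar G → ∀ d → n < (2 ^ d + d) * 4 →
                  ∃[ k ] ThresholdWitness G k × k ≤ 4 * (d + 1) ∸ 1
threshold-bound {n} G planar d n<
  with n ≤? 4 * (d + 1) ∸ 1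
... | yes n≤ = n , threshold-full G , n≤
threshold-bound {n} G planar 0             n< | no n≰ = ⊥-elim (n≰ (≤-pred n<))
threshold-bound {n} G planar 1             n< | no n≰ =
  7 , threshold-small G (<⇒≤ (≰⇒> n≰)) n< S≤56 , ≤-refl
  where
  S≤56 : sum (degree G) ≤ 56
  S≤56 with planar-degree-sum planar
  ... | inj₁ S≡0 = subst (_≤ 56) (sym S≡0) z≤n
  -- With at most eleven vertices, 6 · 11 - 10 = 56.
  ... | inj₂ S+10≤ = +-cancelʳ-≤ 10 _ _ (≤-trans S+10≤ (*-monoʳ-≤ 6 (≤-pred n<)))
threshold-bound {n} G planar (suc (suc e)) n< | no n≰ =
  11 + 4 * e ,
  threshold-large G e (7 + 4 * e) refl (≤-trans (≤-reflexive b≡) (<⇒≤ (≰⇒> n≰))) n< S<6n ,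
  ≤-reflexive b≡
  where
  b≡ : 11 + 4 * e ≡ 4 * (suc (suc e) + 1) ∸ 1
  b≡ = cong (_∸ 1) (expand e)
    where
    expand : ∀ e → 12 + 4 * e ≡ 4 * (suc (suc e) + 1)
    expand = solve-∀
  S<6n : sum (degree G) < 6 * n
  S<6n with planar-degree-sum planar
  ... | inj₁ S≡0 = subst (_< 6 * n) (sym S≡0) (*-monoʳ-< 6 (≤-<-trans z≤n (≰⇒> n≰)))
  ... | inj₂ S+10≤ = <-≤-trans (m<m+n _ z<s) S+10≤

-- The bound in terms of f and of the logarithm

open import Data.Integer using (+_; +<+)

Exceeds⇒< : ∀ n d → Exceeds (+ n / 4) d → n < (2 ^ d + d) * 4
Exceeds⇒< n d (*<* lt) = ℤ.drop‿+<+ (subst₂ ℤ._<_ (ℤ.*-identityʳ (+ n)) (sym (ℤ.pos-* (2 ^ d + d) 4)) lt)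

<⇒Exceeds : ∀ n d → n < (2 ^ d + d) * 4 → Exceeds (+ n / 4) d
<⇒Exceeds n d lt = *<* (subst₂ ℤ._<_ (sym (ℤ.*-identityʳ (+ n))) (ℤ.pos-* (2 ^ d + d) 4) (+<+ lt))

⌈log₂⌉≤⇒≤2^ : ∀ n k → ⌈log₂ n ⌉ ≤ k → n ≤ 2 ^ k
⌈log₂⌉≤⇒≤2^ zero          k       _  = z≤n
⌈log₂⌉≤⇒≤2^ (suc zero)    k       _  = m^n>0 2 k
⌈log₂⌉≤⇒≤2^ n@(suc (suc _)) (suc k) ≤k = begin
  n                      ≡⟨ ⌊n/2⌋+⌈n/2⌉≡n n ⟨
  ⌊ n /2⌋ + ⌈ n /2⌉      ≤⟨ +-monoˡ-≤ ⌈ n /2⌉ (⌊n/2⌋≤⌈n/2⌉ n) ⟩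
  ⌈ n /2⌉ + ⌈ n /2⌉      ≤⟨ +-mono-≤ half half ⟩
  2 ^ k + 2 ^ k          ≡⟨ cong (_+_ (2 ^ k)) (+-identityʳ _) ⟨
  2 ^ suc k              ∎
  where
  open ≤-Reasoning
  half : ⌈ n /2⌉ ≤ 2 ^ k
  half = ⌈log₂⌉≤⇒≤2^ ⌈ n /2⌉ k
    (≤-trans (≤-reflexive (⌈log₂⌈n/2⌉⌉≡⌈log₂n⌉∸1 n)) (∸-monoˡ-≤ 1 ≤k))

-- With `⌈log₂ n ⌉ = l + 2`, the claim is `f (n / 4) ≤ l`, that is, `n < 4 (2 ^ l + l)`. From
-- `n ≤ 4 · 2 ^ l` the summand `l` gives strictness unless `l = 0`, where `n ≢ 4` is used.
f-bound : ∀ n → 3 ≤ n → n ≢ 4 → 4 * (f (+ n / 4) + 1) ∸ 1 ≤ 4 * ⌈log₂ n ⌉ ∸ 5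
f-bound n 3≤n n≢4 with ⌈log₂ n ⌉ | ⌈log₂⌉≤⇒≤2^ n ⌈log₂ n ⌉ ≤-refl
... | 0           | n≤1   = ⊥-elim (<⇒≱ (≤-trans (s≤s (s≤s z≤n)) 3≤n) n≤1)
... | 1           | n≤2   = ⊥-elim (<⇒≱ 3≤n n≤2)
... | suc (suc l) | n≤2^L = begin
  4 * (f (+ n / 4) + 1) ∸ 1   ≤⟨ ∸-monoˡ-≤ 1 (*-monoʳ-≤ 4 (+-monoˡ-≤ 1 f≤l)) ⟩
  4 * (l + 1) ∸ 1                ≡⟨ cong (_∸ 5) (expand l) ⟩
  4 * suc (suc l) ∸ 5            ∎
  where
  open ≤-Reasoning
  expand : ∀ l → 4 + 4 * (l + 1) ≡ 4 * suc (suc l)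
  expand = solve-∀
  below : ∀ l → n ≤ 2 ^ suc (suc l) → n < (2 ^ l + l) * 4
  below zero    n≤4 = ≤∧≢⇒< n≤4 n≢4
  below (suc l) n≤  = ≤-<-trans n≤ (begin-strict
    2 ^ (3 + l)                   ≡⟨ rescale (2 ^ suc l) ⟩
    2 ^ suc l * 4                 <⟨ *-monoˡ-< 4 (m<m+n (2 ^ suc l) z<s) ⟩
    (2 ^ suc l + suc l) * 4       ∎)
    where
    rescale : ∀ p → 2 * (2 * p) ≡ p * 4
    rescale = solve-∀
  f≤l : f (+ n / 4) ≤ l
  f≤l = proj₂ (proj₂ (f-least (+ n / 4))) l (<⇒Exceeds n l (below l n≤2^L))

τ≤4⌈log₂n⌉∸5 : ∀ n (G : Graph n) {τ} → (∀ k → ThresholdWitness G k → τ ≤ k) →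
               τ ≤ 4 * (f (+ n / 4) + 1) ∸ 1 → 3 ≤ n → τ ≤ 4 * ⌈log₂ n ⌉ ∸ 5
τ≤4⌈log₂n⌉∸5 n G minimal τ≤ 3≤n with n ≟ 4
... | yes refl = minimal 3 (threshold-pred G)
... | no  n≢4  = ≤-trans τ≤ (f-bound n 3≤n n≢4)

-- For `n ≥ 3` the logarithm is at least 2, so `∸ 5` is genuine subtraction; for `n = 1` and `n = 2`
-- the intended right-hand side is negative. At `n = 4` the two bounds are 7 and 3, so their
-- comparison excludes it, while the bound 3 on `τ` still holds.
corollary3p6 : ∀ (n : ℕ) (G : Graph n) → Planar G →
    ∃[ τ ] ThresholdDimension G τ
    × τ ≤ 4 * (f (+ n / 4) + 1) ∸ 1
    × (3 ≤ n → τ ≤ 4 * ⌈log₂ n ⌉ ∸ 5)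
    × (3 ≤ n → n ≢ 4 → 4 * (f (+ n / 4) + 1) ∸ 1 ≤ 4 * ⌈log₂ n ⌉ ∸ 5)
corollary3p6 n G planar
  with k , witness , k≤ ← threshold-bound G planar (f (+ n / 4))
         (Exceeds⇒< n (f (+ n / 4)) (proj₁ (proj₂ (f-least (+ n / 4)))))
  with τ , τ-dim , minimal ← thresholdDimension-exists G (k , witness)
  with τ≤ ← ≤-trans (minimal k witness) k≤
  = τ , τ-dim , τ≤ , τ≤4⌈log₂n⌉∸5 n G minimal τ≤ , f-bound n
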